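{- Let $n\ge 1$ and let $\Phi=\{f_1,\ldots,f_k\}$ be a finite subset of the free MV-algebra $\mathbf{F}_n$, with $k$ elements. Let $\mathscr{D}_\Phi$ be the set of all coherent books on $\Phi$ and $\mathscr{K}_\Phi$ the set of all strictly coherent books on $\Phi$, both regarded as subsets of $\mathbb{R}^k$. Then $$\mathscr{K}_\Phi=\mathrm{relint}\,\mathscr{D}_\Phi,$$ where $\mathrm{relint}$ denotes the relative interior of a convex set.
   Context: $\mathbf{F}_n$ is the free $n$-generated MV-algebra, identified with the algebra of all $n$-variable McNaughton functions: continuous functions $f:[0,1]^n\to[0,1]$ that are piecewise linear (affine) with finitely many pieces, each piece having integer coefficients. The operations are pointwise, with $x\oplus y=\min\{1,x+y\}$, $\neg x=1-x$, $x\odot y=\max\{0,x+y-1\}$ on $[0,1]$. Homomorphisms of $\mathbf{F}_n$ into the standard MV-algebra $[0,1]$ (valuations of Łukasiewicz logic) are exactly the evaluations $f\mapsto f(x)$ at points $x\in[0,1]^n$. A book on $\Phi=\{f_1,\ldots,f_k\}$ is a map $\beta:\Phi\to[0,1]$; it is identified with the point $\langle\beta(f_1),\ldots,\beta(f_k)\rangle\in\mathbb{R}^k$. The book $\beta$ is coherent if there are no $\sigma_1,\ldots,\sigma_k\in\mathbb{R}$ such that $\sum_{i=1}^k\sigma_i(\beta(f_i)-f_i(x))<0$ for every $x\in[0,1]^n$. The book $\beta$ is strictly coherent if for all $\sigma_1,\ldots,\sigma_k\in\mathbb{R}$, the existence of $x\in[0,1]^n$ with $\sum_{i=1}^k\sigma_i(\beta(f_i)-f_i(x))<0$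 implies the existence of $x'\in[0,1]^n$ with $\sum_{i=1}^k\sigma_i(\beta(f_i)-f_i(x'))>0$. -}

module Defs where

open import Level using (0ℓ; suc)
open import Algebra.Bundles using (CommutativeRing)
import Algebra.Definitions.RawMonoid as RawMonoidDefs
open import Data.Fin.Base using (Fin)
open import Data.Integer.Base using (ℤ; +_; -[1+_])
open import Data.Nat.Base as ℕ using (ℕ)
open import Data.Product.Base using (Σ; ∃; ∃-syntax; _×_; proj₁)
open import Relation.Binary.Core using (Rel)
import Relation.Binary.Construct.StrictToNonStrict as ToNonStrict
open import Relation.Binary.Structures using (IsStrictTotalOrder)
open import Relation.Nullary.Negation.Core using (¬_)
open import Relation.Unary using (Pred; _∈_)

-- The real numbers, which the library lacks, are specified by their usual
-- axioms: an ordered field with the least upper bound property. Classically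
-- such a field exists and is unique up to isomorphism. Equality is a setoid
-- equality, so that quotient constructions (Cauchy sequences, say) are models.
record CompleteOrderedField : Set (suc 0ℓ) where
  infix 4 _<_ _≤_
  field
    commutativeRing : CommutativeRing 0ℓ 0ℓ

  open CommutativeRing commutativeRing public

  field
    _<_                : Rel Carrier 0ℓ
    isStrictTotalOrder : IsStrictTotalOrder _≈_ _<_
    0≉1                : ¬ (0# ≈ 1#)
    inverse            : ∀ x → ¬ (x ≈ 0#) → ∃[ y ] x * y ≈ 1#
    +-monoˡ-<          : ∀ z {x y} → x < y → x + z < y + z
    *-pos              : ∀ {x y} → 0# < x → 0# < y → 0# < x * y

  _≤_ : Rel Carrier 0ℓ
  _≤_ = ToNonStrict._≤_ _≈_ _<_

  UpperBound : Pred Carrier 0ℓ → Pred Carrier 0ℓ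
  UpperBound P b = ∀ x → x ∈ P → x ≤ b

  field
    supremum : (P : Pred Carrier 0ℓ) → ∃ P → ∃ (UpperBound P) →
               ∃[ s ] UpperBound P s × (∀ b → UpperBound P b → s ≤ b)

  open RawMonoidDefs +-rawMonoid public using (sum) renaming (_×_ to _·_)

  fromℤ : ℤ → Carrier
  fromℤ (+ n)    = n · 1#
  fromℤ -[1+ n ] = - (ℕ.suc n · 1#)

module _ (ℝ : CompleteOrderedField) where
  open CompleteOrderedField ℝ

  Point : ℕ → Set
  Point k = Fin k → Carrier

  InUnit : Pred Carrier 0ℓ
  InUnit x = 0# ≤ x × x ≤ 1#

  Cube : ℕ → Set
  Cube n = Σ (Point n) λ x → ∀ i → InUnit (x i)

  -- Open Euclidean ball; the radius ε is always taken positive, so comparing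
  -- squares avoids square roots.
  Ball : ∀ {k} → Point k → Carrier → Pred (Point k) 0ℓ
  Ball x ε y = sum (λ i → (y i - x i) * (y i - x i)) < ε * ε

  Continuous : ∀ {n} → Pred (Cube n → Carrier) 0ℓ
  Continuous f = ∀ x ε → 0# < ε → ∃[ δ ] 0# < δ ×
    (∀ y → proj₁ y ∈ Ball (proj₁ x) δ → (- ε < f y - f x) × (f y - f x < ε))

  -- Elements of the free n-generated MV-algebra. Together with continuity,
  -- piecewise linearity means that finitely many affine functions suffice to
  -- give the value of f at each point; compatibility with the setoid equality
  -- on points follows from continuity.
  record McNaughton (n : ℕ) : Set where
    field
      fun        : Cube n → Carrier
      inUnit     : ∀ x → InUnit (fun x)
      continuous : Continuous fun
      pieces     : ℕ
      coeff      : Fin pieces → Fin n → ℤ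
      const      : Fin pieces → ℤ
      piecewise  : ∀ x → ∃[ p ]
        fun x ≈ sum (λ i → fromℤ (coeff p i) * proj₁ x i) + fromℤ (const p)

  open McNaughton

  -- Equality of functions: the chosen pieces are disregarded.
  SameFunction : ∀ {n} → Rel (McNaughton n) 0ℓ
  SameFunction f g = ∀ x → fun f x ≈ fun g x

  module _ {n k : ℕ} (f : Fin k → McNaughton n) where

    Book : Pred (Point k) 0ℓ
    Book β = ∀ i → InUnit (β i)

    -- Bettor's stakes σ against the book β, in the valuation x.
    balance : Point k → Point k → Cube n → Carrier
    balance β σ x = sum (λ i → σ i * (β i - fun (f i) x))

    Coherent : Pred (Point k) 0ℓ
    Coherent β = ¬ (∃[ σ ] (∀ x → balance β σ x < 0#))

    StrictlyCoherent : Pred (Point k) 0ℓ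
    StrictlyCoherent β =
      ∀ σ → (∃[ x ] balance β σ x < 0#) → (∃[ x′ ] 0# < balance β σ x′)

    CoherentBooks : Pred (Point k) 0ℓ
    CoherentBooks β = Book β × Coherent β

    StrictlyCoherentBooks : Pred (Point k) 0ℓ
    StrictlyCoherentBooks β = Book β × StrictlyCoherent β

  aff : ∀ {k} → Pred (Point k) 0ℓ → Pred (Point k) 0ℓ
  aff {k} S y = ∃[ m ] Σ (Fin m → Carrier) λ w → Σ (Fin m → Point k) λ s →
    (∀ j → s j ∈ S) × (sum w ≈ 1#) × (∀ i → y i ≈ sum (λ j → w j * s j i))

  relint : ∀ {k} → Pred (Point k) 0ℓ → Pred (Point k) 0ℓ
  relint S x = (x ∈ aff S) ×
    (∃[ ε ] 0# < ε × (∀ y → y ∈ Ball x ε → y ∈ aff S → y ∈ S))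

{-# OPTIONS --safe #-}
-- For a book β put d x = β − ⟨f₁(x), …, fₖ(x)⟩, so that the balance is σ ∙ d x.
-- If β is in the relative interior of the coherent books and the stakes σ lose
-- at x, then β + t d x is still coherent for some t > 0, and the coherence of
-- this book against σ forces a gain at β. Conversely, let β be strictly
-- coherent. The vectors v for which a number T bounds σ ∙ v below by −T m
-- whenever −m bounds all σ ∙ d x below form a convex cone containing β − s for
-- every coherent s. Were the cone not a linear subspace, then a functional
-- nonnegative on the cone and not vanishing on it would contradict strict
-- coherence. In a finite-dimensional subspace T can be chosen proportional to
-- the size of v, hence T < 1 near 0, and this makes every book close to β in the
-- affine hull coherent.
module Submission where

open import Defs
open import Level using (0ℓ)
open import Algebra.Bundles using (CommutativeRing; RawRing)
open import Axiom.ExcludedMiddle using (ExcludedMiddle)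
open import Data.Fin.Base using (Fin; zero; suc)
open import Data.Maybe.Base using (nothing; just)
open import Data.Nat.Base as ℕ using (ℕ; _≥_)
import Data.Nat.Properties as ℕ
open import Data.Product.Base using (Σ; ∃; ∃-syntax; _×_; _,_; proj₁; proj₂)
open import Data.Sum.Base using (_⊎_; inj₁; inj₂)
open import Data.Vec.Functional using ([]; _∷_)
open import Function.Base using (id; _∘_)
open import Function.Definitions using (Injective)
open import Relation.Binary.Bundles using (StrictTotalOrder)
open import Relation.Binary.Definitions using (WeaklyDecidable; tri<; tri≈; tri>)
open import Relation.Binary.PropositionalEquality.Core as ≡ using (_≡_)
open import Relation.Nullary.Decidable.Core using (yes; no; decidable-stable)
open import Relation.Nullary.Negation.Core using (¬_; contradiction)
open import Relation.Unary using (Pred; _∈_; _∉_; _⊆_; _≐_)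

-- Normalisation of ring expressions with integer coefficients.

module RingSolver (R : CommutativeRing 0ℓ 0ℓ) where
  open CommutativeRing R
  open import Algebra.Properties.Ring ring
    using (-‿distribˡ-*; -‿distribʳ-*; -‿involutive; -‿+-comm; -0#≈0#)
  open import Algebra.Properties.CommutativeSemigroup +-commutativeSemigroup
    using (interchange)
  open import Algebra.Properties.Semiring.Mult.TCOptimised semiring
    using (×-homo-+; ×1-homo-*) renaming (_×_ to _·_)
  open import Algebra.Solver.Ring.AlmostCommutativeRing
  open import Relation.Binary.Reasoning.Setoid setoid

  private
    -- Integers as formal differences: the pair `(a , b)` stands for a - b.
    differences : RawRing 0ℓ 0ℓ
    differences = record
      { Carrier = ℕ × ℕ
      ; _≈_     = _≡_
      ; _+_     = λ (a , b) (c , d) → a ℕ.+ c , b ℕ.+ d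
      ; _*_     = λ (a , b) (c , d) → a ℕ.* c ℕ.+ b ℕ.* d , a ℕ.* d ℕ.+ b ℕ.* c
      ; -_      = λ (a , b) → b , a
      ; 0#      = 0 , 0
      ; 1#      = 1 , 0
      }

    -- Reducing to a normal form makes equal coefficients denote definitionally
    -- equal elements.
    ⟦_⟧ : ℕ × ℕ → Carrier
    ⟦ a , 0 ⟧               = a · 1#
    ⟦ 0 , b@(ℕ.suc _) ⟧     = - (b · 1#)
    ⟦ ℕ.suc a , ℕ.suc b ⟧   = ⟦ a , b ⟧

    ⟦⟧≈ : ∀ a b → ⟦ a , b ⟧ ≈ a · 1# - b · 1#
    ⟦⟧≈ a 0                 = sym (trans (+-congˡ -0#≈0#) (+-identityʳ _))
    ⟦⟧≈ 0 (ℕ.suc b)         = sym (+-identityˡ _)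
    ⟦⟧≈ (ℕ.suc a) (ℕ.suc b) = begin
      ⟦ a , b ⟧                                    ≈⟨ ⟦⟧≈ a b ⟩
      a · 1# - b · 1#                              ≈⟨ +-identityˡ _ ⟨
      0# + (a · 1# - b · 1#)                       ≈⟨ +-congʳ (-‿inverseʳ 1#) ⟨
      (1# - 1#) + (a · 1# - b · 1#)                ≈⟨ interchange _ _ _ _ ⟩
      (1# + a · 1#) + (- 1# - b · 1#)
        ≈⟨ +-cong (sym (×-homo-+ 1# 1 a))
                  (trans (-‿+-comm _ _) (-‿cong (sym (×-homo-+ 1# 1 b)))) ⟩
      ℕ.suc a · 1# - ℕ.suc b · 1#                  ∎

    +-homo : ∀ a b c d → ⟦ a ℕ.+ c , b ℕ.+ d ⟧ ≈ ⟦ a , b ⟧ + ⟦ c , d ⟧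
    +-homo a b c d = begin
      ⟦ a ℕ.+ c , b ℕ.+ d ⟧                        ≈⟨ ⟦⟧≈ (a ℕ.+ c) (b ℕ.+ d) ⟩
      (a ℕ.+ c) · 1# - (b ℕ.+ d) · 1#
        ≈⟨ +-cong (×-homo-+ 1# a c)
                  (trans (-‿cong (×-homo-+ 1# b d)) (sym (-‿+-comm _ _))) ⟩
      (a · 1# + c · 1#) + (- (b · 1#) - d · 1#)    ≈⟨ interchange _ _ _ _ ⟩
      (a · 1# - b · 1#) + (c · 1# - d · 1#)
        ≈⟨ +-cong (⟦⟧≈ a b) (⟦⟧≈ c d) ⟨
      ⟦ a , b ⟧ + ⟦ c , d ⟧                        ∎

    expand : ∀ a b c d → (a - b) * (c - d) ≈ (a * c + b * d) - (a * d + b * c)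
    expand a b c d = begin
      (a - b) * (c - d)                                    ≈⟨ distribʳ _ _ _ ⟩
      a * (c - d) + - b * (c - d)
        ≈⟨ +-cong (distribˡ _ _ _) (distribˡ _ _ _) ⟩
      (a * c + a * - d) + (- b * c + - b * - d)            ≈⟨ +-congˡ (+-comm _ _) ⟩
      (a * c + a * - d) + (- b * - d + - b * c)            ≈⟨ interchange _ _ _ _ ⟩
      (a * c + - b * - d) + (a * - d + - b * c)
        ≈⟨ +-cong (+-congˡ b*d) (+-cong (-‿distribʳ-* _ _) (-‿distribˡ-* _ _)) ⟨
      (a * c + b * d) + (- (a * d) + - (b * c))            ≈⟨ +-congˡ (-‿+-comm _ _) ⟩
      (a * c + b * d) - (a * d + b * c)                    ∎
      where
      b*d : b * d ≈ - b * - d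
      b*d = begin
        b * d          ≈⟨ -‿involutive _ ⟨
        - - (b * d)    ≈⟨ -‿cong (-‿distribʳ-* _ _) ⟩
        - (b * - d)    ≈⟨ -‿distribˡ-* _ _ ⟩
        - b * - d      ∎

    ·-*-+ : ∀ a b c d →
      (a ℕ.* b ℕ.+ c ℕ.* d) · 1# ≈ (a · 1#) * (b · 1#) + (c · 1#) * (d · 1#)
    ·-*-+ a b c d =
      trans (×-homo-+ 1# (a ℕ.* b) (c ℕ.* d)) (+-cong (×1-homo-* a b) (×1-homo-* c d))

    *-homo : ∀ a b c d →
      ⟦ a ℕ.* c ℕ.+ b ℕ.* d , a ℕ.* d ℕ.+ b ℕ.* c ⟧ ≈ ⟦ a , b ⟧ * ⟦ c , d ⟧
    *-homo a b c d = begin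
      ⟦ a ℕ.* c ℕ.+ b ℕ.* d , a ℕ.* d ℕ.+ b ℕ.* c ⟧
        ≈⟨ ⟦⟧≈ (a ℕ.* c ℕ.+ b ℕ.* d) (a ℕ.* d ℕ.+ b ℕ.* c) ⟩
      (a ℕ.* c ℕ.+ b ℕ.* d) · 1# - (a ℕ.* d ℕ.+ b ℕ.* c) · 1#
        ≈⟨ +-cong (·-*-+ a c b d) (-‿cong (·-*-+ a d b c)) ⟩
      _ ≈⟨ expand _ _ _ _ ⟨
      (a · 1# - b · 1#) * (c · 1# - d · 1#)
        ≈⟨ *-cong (⟦⟧≈ a b) (⟦⟧≈ c d) ⟨
      ⟦ a , b ⟧ * ⟦ c , d ⟧    ∎

    neg-homo : ∀ a b → ⟦ b , a ⟧ ≈ - ⟦ a , b ⟧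
    neg-homo a b = begin
      ⟦ b , a ⟧                   ≈⟨ ⟦⟧≈ b a ⟩
      b · 1# - a · 1#             ≈⟨ +-comm _ _ ⟩
      - (a · 1#) + b · 1#         ≈⟨ +-congˡ (-‿involutive _) ⟨
      - (a · 1#) - - (b · 1#)     ≈⟨ -‿+-comm _ _ ⟩
      - (a · 1# - b · 1#)         ≈⟨ -‿cong (⟦⟧≈ a b) ⟨
      - ⟦ a , b ⟧                 ∎

    morphism : differences -Raw-AlmostCommutative⟶ fromCommutativeRing R
    morphism = record
      { ⟦_⟧    = ⟦_⟧
      ; +-homo = λ (a , b) (c , d) → +-homo a b c d
      ; *-homo = λ (a , b) (c , d) → *-homo a b c d
      ; -‿homo = λ (a , b) → neg-homo a b
      ; 0-homo = refl
      ; 1-homo = refl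
      }

    differences≟ : WeaklyDecidable (Induced-equivalence morphism)
    differences≟ (a , b) (c , d) with (a ℕ.+ d) ℕ.≟ (c ℕ.+ b)
    ... | no _   = nothing
    ... | yes eq = just (begin
      ⟦ a , b ⟧                        ≈⟨ +-identityʳ _ ⟨
      ⟦ a , b ⟧ + 0#                   ≈⟨ +-congˡ (trans (⟦⟧≈ d d) (-‿inverseʳ _)) ⟨
      ⟦ a , b ⟧ + ⟦ d , d ⟧            ≈⟨ +-homo a b d d ⟨
      ⟦ a ℕ.+ d , b ℕ.+ d ⟧            ≡⟨ ≡.cong₂ (λ m n → ⟦ m , n ⟧) eq (ℕ.+-comm b d) ⟩
      ⟦ c ℕ.+ b , d ℕ.+ b ⟧            ≈⟨ +-homo c d b b ⟩
      ⟦ c , d ⟧ + ⟦ b , b ⟧            ≈⟨ +-congˡ (trans (⟦⟧≈ b b) (-‿inverseʳ _)) ⟩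
      ⟦ c , d ⟧ + 0#                   ≈⟨ +-identityʳ _ ⟩
      ⟦ c , d ⟧                        ∎)

  open import Algebra.Solver.Ring differences (fromCommutativeRing R) morphism differences≟
    public using (Polynomial; con; solve; _:+_; _:*_; _:-_; :-_; _:=_)

  𝟘 𝟙 : ∀ {n} → Polynomial n
  𝟘 = con (0 , 0)
  𝟙 = con (1 , 0)

-- Arithmetic of ordered fields, finite sums and inner products.

module OrderedField (ℝ : CompleteOrderedField) where
  open CompleteOrderedField ℝ hiding (zero; _≤_) public
  open RingSolver commutativeRing

  strictTotalOrder : StrictTotalOrder 0ℓ 0ℓ 0ℓ
  strictTotalOrder = record { isStrictTotalOrder = isStrictTotalOrder }

  open StrictTotalOrder strictTotalOrder public
    using (compare; asym; irrefl; <-respˡ-≈; <-respʳ-≈; strictPartialOrder)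
    renaming (trans to <-trans)
  open import Relation.Binary.Properties.StrictTotalOrder strictTotalOrder public
    using (_≤_; ≤-respʳ-≈; antisym)
    renaming (refl to ≤-refl; reflexive to ≤-reflexive; total to ≤-total)
  open import Relation.Binary.Reasoning.StrictPartialOrder strictPartialOrder public
    hiding (strict)

  <⇒≤ : ∀ {x y} → x < y → x ≤ y
  <⇒≤ = inj₁

  <⇒≱ : ∀ {x y} → x < y → ¬ (y ≤ x)
  <⇒≱ x<y (inj₁ y<x) = asym x<y y<x
  <⇒≱ x<y (inj₂ y≈x) = irrefl (sym y≈x) x<y

  ≮⇒≥ : ∀ {x y} → ¬ (x < y) → y ≤ x
  ≮⇒≥ {x} {y} x≮y with compare x y
  ... | tri< x<y _ _ = contradiction x<y x≮y
  ... | tri≈ _ x≈y _ = inj₂ (sym x≈y)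
  ... | tri> _ _ y<x = inj₁ y<x

  x<y⇒0<y-x : ∀ {x y} → x < y → 0# < y - x
  x<y⇒0<y-x {x} {y} x<y = <-respˡ-≈ (-‿inverseʳ x) (+-monoˡ-< (- x) x<y)

  0<y-x⇒x<y : ∀ {x y} → 0# < y - x → x < y
  0<y-x⇒x<y {x} {y} 0<y-x = begin-strict
    x            ≈⟨ +-identityˡ x ⟨
    0# + x       <⟨ +-monoˡ-< x 0<y-x ⟩
    y - x + x    ≈⟨ solve 2 (λ x y → y :- x :+ x := y) refl x y ⟩
    y            ∎

  x≤y⇒0≤y-x : ∀ {x y} → x ≤ y → 0# ≤ y - x
  x≤y⇒0≤y-x (inj₁ x<y)         = inj₁ (x<y⇒0<y-x x<y)
  x≤y⇒0≤y-x {x} {y} (inj₂ x≈y) =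
    inj₂ (sym (trans (+-congʳ (sym x≈y)) (-‿inverseʳ x)))

  0≤y-x⇒x≤y : ∀ {x y} → 0# ≤ y - x → x ≤ y
  0≤y-x⇒x≤y {x} {y} 0≤y-x = ≮⇒≥ λ y<x → <⇒≱ (x<y⇒0<y-x y<x) (begin
    x - y            ≈⟨ solve 2 (λ x y → x :- y := 𝟘 :- (y :- x)) refl x y ⟩
    0# - (y - x)     ≤⟨ lemma 0≤y-x ⟩
    0#               ∎)
    where
    lemma : ∀ {z} → 0# ≤ z → 0# - z ≤ 0#
    lemma {z} (inj₁ 0<z) = inj₁ (0<y-x⇒x<y
      (<-respʳ-≈ (solve 1 (λ z → z := 𝟘 :- (𝟘 :- z)) refl z) 0<z))
    lemma {z} (inj₂ 0≈z) = inj₂ (trans (+-congˡ (-‿cong (sym 0≈z))) (-‿inverseʳ 0#))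

  x<0⇒0<-x : ∀ {x} → x < 0# → 0# < - x
  x<0⇒0<-x {x} x<0 = <-respʳ-≈ (+-identityˡ (- x)) (x<y⇒0<y-x x<0)

  0<-x⇒x<0 : ∀ {x} → 0# < - x → x < 0#
  0<-x⇒x<0 {x} 0<-x = 0<y-x⇒x<y (<-respʳ-≈ (sym (+-identityˡ (- x))) 0<-x)

  0<x⇒-x<0 : ∀ {x} → 0# < x → - x < 0#
  0<x⇒-x<0 {x} 0<x = 0<-x⇒x<0 (<-respʳ-≈ (solve 1 (λ x → x := :- (:- x)) refl x) 0<x)

  x≤0⇒0≤-x : ∀ {x} → x ≤ 0# → 0# ≤ - x
  x≤0⇒0≤-x {x} x≤0 = ≤-respʳ-≈ (+-identityˡ (- x)) (x≤y⇒0≤y-x x≤0)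

  nonneg-or-nonpos : ∀ x → 0# ≤ x ⊎ 0# ≤ - x
  nonneg-or-nonpos x with ≤-total 0# x
  ... | inj₁ 0≤x = inj₁ 0≤x
  ... | inj₂ x≤0 = inj₂ (x≤0⇒0≤-x x≤0)

  +-pos-nonneg : ∀ {x y} → 0# < x → 0# ≤ y → 0# < x + y
  +-pos-nonneg {x} {y} 0<x (inj₁ 0<y) = begin-strict
    0#        <⟨ 0<y ⟩
    y         ≈⟨ +-identityˡ y ⟨
    0# + y    <⟨ +-monoˡ-< y 0<x ⟩
    x + y     ∎
  +-pos-nonneg {x} {y} 0<x (inj₂ 0≈y) =
    <-respʳ-≈ (trans (sym (+-identityʳ x)) (+-congˡ 0≈y)) 0<x

  +-nonneg : ∀ {x y} → 0# ≤ x → 0# ≤ y → 0# ≤ x + y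
  +-nonneg (inj₁ 0<x) 0≤y = inj₁ (+-pos-nonneg 0<x 0≤y)
  +-nonneg {x} {y} (inj₂ 0≈x) 0≤y =
    ≤-respʳ-≈ (trans (sym (+-identityˡ y)) (+-congʳ 0≈x)) 0≤y

  *-nonneg : ∀ {x y} → 0# ≤ x → 0# ≤ y → 0# ≤ x * y
  *-nonneg (inj₁ 0<x) (inj₁ 0<y) = inj₁ (*-pos 0<x 0<y)
  *-nonneg {x} {y} (inj₂ 0≈x) _  = inj₂ (trans (sym (zeroˡ y)) (*-congʳ 0≈x))
  *-nonneg {x} {y} _ (inj₂ 0≈y)  = inj₂ (trans (sym (zeroʳ x)) (*-congˡ 0≈y))

  square-nonneg : ∀ x → 0# ≤ x * x
  square-nonneg x with nonneg-or-nonpos x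
  ... | inj₁ 0≤x  = *-nonneg 0≤x 0≤x
  ... | inj₂ 0≤-x = ≤-respʳ-≈ (solve 1 (λ x → :- x :* :- x := x :* x) refl x)
                              (*-nonneg 0≤-x 0≤-x)

  0<1 : 0# < 1#
  0<1 with compare 0# 1#
  ... | tri< p _ _ = p
  ... | tri≈ _ e _ = contradiction e 0≉1
  ... | tri> _ _ p = contradiction (≤-respʳ-≈ (*-identityʳ 1#) (square-nonneg 1#)) (<⇒≱ p)

  pos-inverse : ∀ {x} → 0# < x → ∃[ y ] 0# < y × x * y ≈ 1#
  pos-inverse {x} 0<x with inverse x (λ x≈0 → irrefl (sym x≈0) 0<x)
  ... | y , xy≈1 with compare 0# y
  ...   | tri< 0<y _ _ = y , 0<y , xy≈1
  ...   | tri≈ _ 0≈y _ =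
    contradiction (trans (sym (zeroʳ x)) (trans (*-congˡ 0≈y) xy≈1)) 0≉1
  ...   | tri> _ _ y<0 = contradiction 0<1 (asym (0<-x⇒x<0 (begin-strict
    0#           <⟨ *-pos 0<x (x<0⇒0<-x y<0) ⟩
    x * - y      ≈⟨ solve 2 (λ x y → x :* :- y := :- (x :* y)) refl x y ⟩
    - (x * y)    ≈⟨ -‿cong xy≈1 ⟩
    - 1#         ∎)))

  -- This is |x| ≤ r, split into two linear inequalities so that estimates become sums and products
  -- of nonnegative terms.
  Within : Carrier → Pred Carrier 0ℓ
  Within r x = 0# ≤ r + x × 0# ≤ r - x

  square<⇒within : ∀ {r x} → 0# < r → x * x < r * r → Within r x
  square<⇒within {r} {x} 0<r xx<rr = half x xx<rr ,
    half (- x) (<-respˡ-≈ (solve 1 (λ x → x :* x := :- x :* :- x) refl x) xx<rr)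
    where
    half : ∀ x → x * x < r * r → 0# ≤ r + x
    -- If p = -(r + x) were positive, then x² - r² = p (p + 2r) would be positive too.
    half x xx<rr = ≮⇒≥ λ r+x<0 → asym xx<rr (0<y-x⇒x<y (begin-strict
      0#                           <⟨ *-pos (x<0⇒0<-x r+x<0) (+-pos-nonneg (x<0⇒0<-x r+x<0)
                                        (<⇒≤ (+-pos-nonneg 0<r (<⇒≤ 0<r)))) ⟩
      - (r + x) * (- (r + x) + (r + r))
        ≈⟨ solve 2 (λ r x → :- (r :+ x) :* (:- (r :+ x) :+ (r :+ r))
                            := x :* x :- r :* r) refl r x ⟩
      x * x - r * r                ∎))

  within-bound : ∀ x → ∃[ r ] 0# ≤ r × Within r x
  within-bound x with nonneg-or-nonpos x
  ... | inj₁ 0≤x  = x , 0≤x , +-nonneg 0≤x 0≤x , ≤-reflexive (sym (-‿inverseʳ x))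
  ... | inj₂ 0≤-x = - x , 0≤-x , ≤-reflexive (sym (-‿inverseˡ x)) , +-nonneg 0≤-x 0≤-x

  within-mono : ∀ {r s x} → r ≤ s → Within r x → Within s x
  within-mono {r} {s} {x} r≤s (p , q) =
    ≤-respʳ-≈ (solve 3 (λ r s x → (s :- r) :+ (r :+ x) := s :+ x) refl r s x)
      (+-nonneg (x≤y⇒0≤y-x r≤s) p) ,
    ≤-respʳ-≈ (solve 3 (λ r s x → (s :- r) :+ (r :- x) := s :- x) refl r s x)
      (+-nonneg (x≤y⇒0≤y-x r≤s) q)

  0≤x+x⇒0≤x : ∀ {x} → 0# ≤ x + x → 0# ≤ x
  0≤x+x⇒0≤x {x} 0≤x+x = ≮⇒≥ λ x<0 → <⇒≱ (0<-x⇒x<0 (<-respʳ-≈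
    (solve 1 (λ x → (:- x) :+ (:- x) := :- (x :+ x)) refl x)
    (+-pos-nonneg (x<0⇒0<-x x<0) (<⇒≤ (x<0⇒0<-x x<0))))) 0≤x+x

  -- r s ± x y is half of (r + x)(s ± y) + (r − x)(s ∓ y).
  within-* : ∀ {r s x y} → Within r x → Within s y → Within (r * s) (x * y)
  within-* {r} {s} {x} {y} (0≤r+x , 0≤r-x) (0≤s+y , 0≤s-y) =
    0≤x+x⇒0≤x (≤-respʳ-≈
      (solve 4 (λ r s x y → (r :+ x) :* (s :+ y) :+ (r :- x) :* (s :- y)
        := (r :* s :+ x :* y) :+ (r :* s :+ x :* y)) refl r s x y)
      (+-nonneg (*-nonneg 0≤r+x 0≤s+y) (*-nonneg 0≤r-x 0≤s-y))) ,
    0≤x+x⇒0≤x (≤-respʳ-≈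
      (solve 4 (λ r s x y → (r :+ x) :* (s :- y) :+ (r :- x) :* (s :+ y)
        := (r :* s :- x :* y) :+ (r :* s :- x :* y)) refl r s x y)
      (+-nonneg (*-nonneg 0≤r+x 0≤s-y) (*-nonneg 0≤r-x 0≤s+y)))

  within-- : ∀ {r s x y} → Within r x → Within s y → Within (r + s) (x - y)
  within-- {r} {s} {x} {y} (0≤r+x , 0≤r-x) (0≤s+y , 0≤s-y) =
    ≤-respʳ-≈ (solve 4 (λ r s x y → (r :+ x) :+ (s :- y) := (r :+ s) :+ (x :- y)) refl r s x y)
      (+-nonneg 0≤r+x 0≤s-y) ,
    ≤-respʳ-≈ (solve 4 (λ r s x y → (r :- x) :+ (s :+ y) := (r :+ s) :- (x :- y)) refl r s x y)
      (+-nonneg 0≤r-x 0≤s+y)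

  -- Additivity, homogeneity and congruence of sums in a single law. The pointwise hypothesis on `w`
  -- takes the place of function extensionality.
  sum-comb : ∀ {n} {w u v : Fin n → Carrier} a b →
    (∀ i → w i ≈ a * u i + b * v i) → sum w ≈ a * sum u + b * sum v
  sum-comb {0} a b _ = solve 2 (λ a b → 𝟘 := a :* 𝟘 :+ b :* 𝟘) refl a b
  sum-comb {ℕ.suc n} {w} {u} {v} a b w≈ = begin-equality
    w zero + sum (w ∘ suc)    ≈⟨ +-cong (w≈ zero) (sum-comb a b (w≈ ∘ suc)) ⟩
    _ ≈⟨ solve 6 (λ a b u v U V → (a :* u :+ b :* v) :+ (a :* U :+ b :* V)
                                  := a :* (u :+ U) :+ b :* (v :+ V))
           refl a b (u zero) (v zero) (sum (u ∘ suc)) (sum (v ∘ suc)) ⟩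
    a * sum u + b * sum v     ∎

  sum-zero : ∀ {n} {u : Fin n → Carrier} → (∀ i → u i ≈ 0#) → sum u ≈ 0#
  sum-zero {u = u} u≈0 = begin-equality
    sum u                      ≈⟨ sum-comb {u = u} {v = u} 0# 0# (λ i → trans (u≈0 i)
                                    (solve 1 (λ x → 𝟘 := 𝟘 :* x :+ 𝟘 :* x) refl (u i))) ⟩
    0# * sum u + 0# * sum u    ≈⟨ solve 1 (λ x → 𝟘 :* x :+ 𝟘 :* x := 𝟘) refl (sum u) ⟩
    0#                         ∎

  sum-nonneg : ∀ {n} {u : Fin n → Carrier} → (∀ i → 0# ≤ u i) → 0# ≤ sum u
  sum-nonneg {0}       _   = ≤-refl
  sum-nonneg {ℕ.suc n} 0≤u = +-nonneg (0≤u zero) (sum-nonneg (0≤u ∘ suc))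

  term≤sum : ∀ {n} {u : Fin n → Carrier} → (∀ i → 0# ≤ u i) → ∀ i → u i ≤ sum u
  term≤sum {ℕ.suc n} {u} 0≤u i = 0≤y-x⇒x≤y (go i)
    where
    go : ∀ i → 0# ≤ sum u - u i
    go zero = ≤-respʳ-≈ (solve 2 (λ x y → y := x :+ y :- x) refl (u zero) (sum (u ∘ suc)))
      (sum-nonneg (0≤u ∘ suc))
    go (suc i) = ≤-respʳ-≈ (solve 3 (λ x y z → x :+ (y :- z) := x :+ y :- z) refl
        (u zero) (sum (u ∘ suc)) (u (suc i)))
      (+-nonneg (0≤u zero) (x≤y⇒0≤y-x (term≤sum (0≤u ∘ suc) i)))

  infix 8 _∙_
  _∙_ : ∀ {k} → (Fin k → Carrier) → (Fin k → Carrier) → Carrier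
  σ ∙ v = sum λ i → σ i * v i

  ∙-comb : ∀ {k} {w u v : Fin k → Carrier} σ a b →
    (∀ i → w i ≈ a * u i + b * v i) → σ ∙ w ≈ a * (σ ∙ u) + b * (σ ∙ v)
  ∙-comb {w = w} {u} {v} σ a b w≈ = sum-comb a b λ i → trans (*-congˡ (w≈ i))
    (solve 5 (λ s a b u v → s :* (a :* u :+ b :* v) := a :* (s :* u) :+ b :* (s :* v))
      refl (σ i) a b (u i) (v i))

  neg : ∀ {k} → (Fin k → Carrier) → (Fin k → Carrier)
  neg v i = - v i

  ∙-negʳ : ∀ {k} (σ v : Fin k → Carrier) → σ ∙ neg v ≈ - (σ ∙ v)
  ∙-negʳ σ v = trans
    (∙-comb {u = v} {v} σ (- 1#) 0# λ i → solve 1 (λ x → :- x := :- 𝟙 :* x :+ 𝟘 :* x) refl (v i))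
    (solve 1 (λ x → :- 𝟙 :* x :+ 𝟘 :* x := :- x) refl (σ ∙ v))

  ∙-comm : ∀ {k} (u v : Fin k → Carrier) → u ∙ v ≈ v ∙ u
  ∙-comm {0}       u v = refl
  ∙-comm {ℕ.suc k} u v = +-cong (*-comm _ _) (∙-comm (u ∘ suc) (v ∘ suc))

  ∙-negˡ : ∀ {k} (σ v : Fin k → Carrier) → neg σ ∙ v ≈ - (σ ∙ v)
  ∙-negˡ σ v = trans (∙-comm (neg σ) v) (trans (∙-negʳ v σ) (-‿cong (∙-comm v σ)))

  ∙-self-nonneg : ∀ {k} (v : Fin k → Carrier) → 0# ≤ v ∙ v
  ∙-self-nonneg v = sum-nonneg λ i → square-nonneg (v i)

  unit : ∀ {k} → Fin k → Fin k → Carrier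
  unit zero    zero    = 1#
  unit zero    (suc j) = 0#
  unit (suc i) zero    = 0#
  unit (suc i) (suc j) = unit i j

  unit-∙ : ∀ {k} i (v : Fin k → Carrier) → unit i ∙ v ≈ v i
  unit-∙ zero    v = trans
    (+-cong (*-identityˡ _) (sum-zero {u = λ i → 0# * v (suc i)} λ i → zeroˡ _))
    (+-identityʳ _)
  unit-∙ (suc i) v = trans (+-cong (zeroˡ _) (unit-∙ i (v ∘ suc))) (+-identityˡ _)

  unit-sym : ∀ {k} (i j : Fin k) → unit i j ≈ unit j i
  unit-sym zero    zero    = refl
  unit-sym zero    (suc j) = refl
  unit-sym (suc i) zero    = refl
  unit-sym (suc i) (suc j) = unit-sym i j

-- Separation for convex cones in finite dimension.

module Cones (em : ExcludedMiddle 0ℓ) (ℝ : CompleteOrderedField) {k : ℕ} where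
  open OrderedField ℝ
  open RingSolver commutativeRing

  private
    V : Set
    V = Fin k → Carrier

  -- Letting `w` be any pointwise copy of the combination builds in closure under the setoid
  -- equality. The empty predicate qualifies, so inhabitants are supplied separately where the zero
  -- vector must be present.
  IsCone IsSubspace : Pred V 0ℓ → Set
  IsCone K = ∀ {u v w} a b → 0# ≤ a → 0# ≤ b → K u → K v →
    (∀ i → w i ≈ a * u i + b * v i) → K w
  IsSubspace W = ∀ {u v w} a b → W u → W v → (∀ i → w i ≈ a * u i + b * v i) → W w

  -- The lineality space: for an inhabited cone, the largest linear subspace inside it.
  lin : Pred V 0ℓ → Pred V 0ℓ
  lin K v = K v × K (neg v)

  module _ {K : Pred V 0ℓ} (cone : IsCone K) where

    cone-scale : ∀ {u w} a → 0# ≤ a → K u → (∀ i → w i ≈ a * u i) → K w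
    cone-scale {u} a 0≤a Ku w≈ = cone a 0# 0≤a ≤-refl Ku Ku λ i → trans (w≈ i)
      (solve 2 (λ a u → a :* u := a :* u :+ 𝟘 :* u) refl a (u i))

    cone-resp : ∀ {u w} → K u → (∀ i → w i ≈ u i) → K w
    cone-resp Ku w≈ = cone-scale 1# (<⇒≤ 0<1) Ku λ i → trans (w≈ i) (sym (*-identityˡ _))

    lin-scale : ∀ {u w} a → lin K u → (∀ i → w i ≈ a * u i) → lin K w
    lin-scale {u} a (Ku , K-u) w≈ with nonneg-or-nonpos a
    ... | inj₁ 0≤a  = cone-scale a 0≤a Ku w≈ , cone-scale a 0≤a K-u λ i → trans (-‿cong (w≈ i))
      (solve 2 (λ a u → :- (a :* u) := a :* :- u) refl a (u i))
    ... | inj₂ 0≤-a = cone-scale (- a) 0≤-a K-u (λ i → trans (w≈ i)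
      (solve 2 (λ a u → a :* u := :- a :* :- u) refl a (u i))) ,
      cone-scale (- a) 0≤-a Ku λ i → trans (-‿cong (w≈ i))
      (solve 2 (λ a u → :- (a :* u) := :- a :* u) refl a (u i))

    lin-isSubspace : IsSubspace (lin K)
    lin-isSubspace {u} {v} a b u∈ v∈ w≈
      with lin-scale a u∈ (λ _ → refl) | lin-scale b v∈ (λ _ → refl)
    ... | p , p′ | q , q′ =
      cone 1# 1# (<⇒≤ 0<1) (<⇒≤ 0<1) p q (λ i → trans (w≈ i)
        (solve 2 (λ x y → x :+ y := 𝟙 :* x :+ 𝟙 :* y) refl (a * u i) (b * v i))) ,
      cone 1# 1# (<⇒≤ 0<1) (<⇒≤ 0<1) p′ q′ λ i → trans (-‿cong (w≈ i))
        (solve 2 (λ x y → :- (x :+ y) := 𝟙 :* :- x :+ 𝟙 :* :- y) refl (a * u i) (b * v i))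

  subspace-sum : ∀ {W} → IsSubspace W → ∃ W → ∀ {m} (a : Fin m → Carrier) (u : Fin m → V) →
    (∀ j → W (u j)) → W (λ i → sum λ j → a j * u j i)
  subspace-sum sub (v , Wv) {0} a u Wu =
    sub 0# 0# Wv Wv λ i → solve 1 (λ x → 𝟘 := 𝟘 :* x :+ 𝟘 :* x) refl (v i)
  subspace-sum sub ∃W {ℕ.suc m} a u Wu =
    sub (a zero) 1# (Wu zero) (subspace-sum sub ∃W (a ∘ suc) (u ∘ suc) (Wu ∘ suc))
      λ i → +-congˡ (sym (*-identityˡ _))

  infixl 6 _⊕_
  -- The Minkowski sum of `K` with the line through `d`.
  _⊕_ : Pred V 0ℓ → V → Pred V 0ℓ
  (K ⊕ d) v = ∃[ s ] K (λ i → v i + s * d i)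

  ⊕-isCone : ∀ {K} → IsCone K → ∀ d → IsCone (K ⊕ d)
  ⊕-isCone cone d {u} {v} {w} a b 0≤a 0≤b (s , Ku) (t , Kv) w≈ =
    a * s + b * t , cone a b 0≤a 0≤b Ku Kv λ i → trans (+-congʳ (w≈ i))
      (solve 7 (λ a b s t u v d → (a :* u :+ b :* v) :+ (a :* s :+ b :* t) :* d
                                  := a :* (u :+ s :* d) :+ b :* (v :+ t :* d))
        refl a b s t (u i) (v i) (d i))

  ⊆-⊕ : ∀ {K} → IsCone K → ∀ d → K ⊆ K ⊕ d
  ⊆-⊕ cone d {v} Kv = 0# , cone-resp cone Kv λ i →
    solve 2 (λ v d → v :+ 𝟘 :* d := v) refl (v i) (d i)

  lin-⊆-⊕ : ∀ {K} → IsCone K → ∀ d → lin K ⊆ lin (K ⊕ d)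
  lin-⊆-⊕ cone d (p , q) = ⊆-⊕ cone d p , ⊆-⊕ cone d q

  direction∈lin : ∀ {K} → IsCone K → ∃ K → ∀ d → d ∈ lin (K ⊕ d)
  direction∈lin cone (u , Ku) d =
    -- The shift cancels `d` and leaves the zero vector, which lies in `K` as zero times `u`.
    (- 1# , cone-scale cone 0# ≤-refl Ku λ i →
      solve 2 (λ d u → d :+ :- 𝟙 :* d := 𝟘 :* u) refl (d i) (u i)) ,
    (1# , cone-scale cone 0# ≤-refl Ku λ i →
      solve 2 (λ d u → :- d :+ 𝟙 :* d := 𝟘 :* u) refl (d i) (u i))

  -- The vector `e` witnesses that the cone is not a linear subspace. Contrary to a common use of
  -- the word, the lineality space may be nonzero.
  record Pointed (K : Pred V 0ℓ) (e : V) : Set where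
    field
      cone : IsCone K
      e∈K  : e ∈ K
      -e∉K : neg e ∉ K

    negative∉K : ∀ {v} r → r < 0# → (∀ i → v i ≈ r * e i) → v ∉ K
    negative∉K {v} r r<0 v≈ Kv with pos-inverse (x<0⇒0<-x r<0)
    ... | s , 0<s , -rs≈1 = -e∉K (cone-scale cone s (<⇒≤ 0<s) Kv λ i → begin-equality
      - e i              ≈⟨ -‿cong (trans (*-congʳ -rs≈1) (*-identityˡ _)) ⟨
      - (- r * s * e i)
        ≈⟨ solve 3 (λ r s e → :- (:- r :* s :* e) := s :* (r :* e)) refl r s (e i) ⟩
      s * (r * e i)      ≈⟨ *-congˡ (v≈ i) ⟨
      s * v i            ∎)

  -- Modulo the lineality space, `v` equals `l e`. Once this holds for all standard basis vectors,
  -- their coefficients `l` are the coordinates of a separating functional.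
  Spanned : Pred V 0ℓ → V → V → Set
  Spanned K e v = ∃[ l ] (λ i → v i - l * e i) ∈ lin K

  -- The second clause excludes functionals that vanish on all of `K`.
  Separable : Pred V 0ℓ → Set
  Separable K = ∃[ φ ] (∀ {v} → K v → 0# ≤ φ ∙ v) × (∃[ v ] K v × 0# < φ ∙ v)

  -- Both `d` and its negative lie in `K ⊕ d`, so `φ` vanishes on `d`. The witness of positivity can
  -- therefore be moved along `d` into `K` without changing its value.
  separable-⊕ : ∀ {K} → IsCone K → ∃ K → ∀ d → Separable (K ⊕ d) → Separable K
  separable-⊕ {K} cone ∃K d (φ , φ≥0 , v , (s , Kv) , 0<φv) =
    φ , (φ≥0 ∘ ⊆-⊕ cone d) , _ , Kv , <-respʳ-≈ (begin-equality
      φ ∙ v                           ≈⟨ solve 2 (λ x s → x := 𝟙 :* x :+ s :* 𝟘) refl (φ ∙ v) s ⟩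
      1# * (φ ∙ v) + s * 0#           ≈⟨ +-congˡ (*-congˡ φd≈0) ⟨
      1# * (φ ∙ v) + s * (φ ∙ d)      ≈⟨ ∙-comb {u = v} {d} φ 1# s (λ i → +-congʳ (sym (*-identityˡ _))) ⟨
      _                               ∎) 0<φv
    where
    φd≈0 : φ ∙ d ≈ 0#
    φd≈0 with direction∈lin cone ∃K d
    ... | p , q = antisym
      (0≤y-x⇒x≤y (≤-respʳ-≈ (trans (∙-negʳ φ d) (sym (+-identityˡ _))) (φ≥0 q)))
      (φ≥0 p)

  -- One stage of a finite Hahn-Banach argument: progress in spanning is kept, and separability
  -- passes back to the original cone. The distinguished vector may change.
  record Extension (K : Pred V 0ℓ) (e : V) : Set₁ where
    field
      {K′}      : Pred V 0ℓ
      {e′}      : V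
      pointed   : Pointed K′ e′
      spanned   : ∀ {v} → Spanned K e v → Spanned K′ e′ v
      separable : Separable K′ → Separable K

  ExtensionSpanning : Pred V 0ℓ → V → V → Set₁
  ExtensionSpanning K e b =
    Σ (Extension K e) λ E → Spanned (Extension.K′ E) (Extension.e′ E) b

  spanning-neg : ∀ {K e b} → ExtensionSpanning K e (neg b) → ExtensionSpanning K e b
  spanning-neg {b = b} (E , l , p) = E , - l , lin-scale (Pointed.cone pointed) (- 1#) p λ i →
    solve 3 (λ b l e → b :- (:- l) :* e := :- 𝟙 :* (:- b :- l :* e)) refl (b i) l (e′ i)
    where open Extension E

  module _ {K e} (P : Pointed K e) where
    open Pointed P

    -- Any l between the two sets makes it safe to identify b with l e: the cone
    -- enlarged by the line of b − l e still avoids −e.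
    Below Above : V → Pred Carrier 0ℓ
    Below b t = (λ i → b i - t * e i) ∈ K
    Above b t = (λ i → t * e i - b i) ∈ K

    -- The two memberships add up to (t - s) e in `K`, and `K` contains no negative multiple of `e`.
    below≤above : ∀ b s t → s ∈ Below b → t ∈ Above b → s ≤ t
    below≤above b s t s∈ t∈ = ≮⇒≥ λ t<s → negative∉K (t - s)
      (0<-x⇒x<0 (<-respʳ-≈ (solve 2 (λ s t → s :- t := :- (t :- s)) refl s t) (x<y⇒0<y-x t<s)))
      (λ _ → refl)
      (cone 1# 1# (<⇒≤ 0<1) (<⇒≤ 0<1) s∈ t∈ λ i →
        solve 4 (λ s t e b → (t :- s) :* e := 𝟙 :* (b :- s :* e) :+ 𝟙 :* (t :* e :- b))
          refl s t (e i) (b i))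

    extend-at : ∀ b l → UpperBound (Below b) l → (∀ t → t ∈ Above b → l ≤ t) →
      ExtensionSpanning K e b
    extend-at b l upper lower = record
      { pointed = record
        { cone = ⊕-isCone cone d
        ; e∈K  = ⊆-⊕ cone d e∈K
        ; -e∉K = -e∉K⊕d
        }
      ; spanned   = λ (c , p) → c , lin-⊆-⊕ cone d p
      ; separable = separable-⊕ cone (e , e∈K) d
      } , l , direction∈lin cone (e , e∈K) d
      where
      d : V
      d i = b i - l * e i

      -e∉K⊕d : neg e ∉ K ⊕ d
      -e∉K⊕d (s , Kv) with compare 0# s
      ... | tri≈ _ 0≈s _ = -e∉K (cone-resp cone Kv λ i → begin-equality
        - e i               ≈⟨ solve 2 (λ e d → :- e := :- e :+ 𝟘 :* d) refl (e i) (d i) ⟩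
        - e i + 0# * d i    ≈⟨ +-congˡ (*-congʳ 0≈s) ⟩
        - e i + s * d i     ∎)
      -- Dividing -e + s d by s gives b - (l + w) e with w = 1/s, so `l + w` would be in `Below b`
      -- and exceed its upper bound `l`.
      ... | tri< 0<s _ _ with pos-inverse 0<s
      ...   | w , 0<w , sw≈1 = <⇒≱ (0<y-x⇒x<y (<-respʳ-≈
          (solve 2 (λ l w → w := l :+ w :- l) refl l w) 0<w))
        (upper (l + w) (cone-scale cone w (<⇒≤ 0<w) Kv λ i → begin-equality
          b i - (l + w) * e i
            ≈⟨ solve 4 (λ b l w e → b :- (l :+ w) :* e := :- (w :* e) :+ 𝟙 :* (b :- l :* e))
                 refl (b i) l w (e i) ⟩
          - (w * e i) + 1# * d i       ≈⟨ +-congˡ (*-congʳ sw≈1) ⟨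
          - (w * e i) + s * w * d i
            ≈⟨ solve 4 (λ s w e d → :- (w :* e) :+ s :* w :* d := w :* (:- e :+ s :* d))
                 refl s w (e i) (d i) ⟩
          w * (- e i + s * d i)        ∎))
      -- Symmetrically, with w = -1/s the number `l - w` would be in `Above b` and yet smaller than
      -- `l`.
      -e∉K⊕d (s , Kv) | tri> _ _ s<0 with pos-inverse (x<0⇒0<-x s<0)
      ...   | w , 0<w , -sw≈1 = <⇒≱ (0<y-x⇒x<y (<-respʳ-≈
          (solve 2 (λ l w → w := l :- (l :- w)) refl l w) 0<w))
        (lower (l - w) (cone-scale cone w (<⇒≤ 0<w) Kv λ i → begin-equality
          (l - w) * e i - b i
            ≈⟨ solve 4 (λ b l w e → (l :- w) :* e :- b := :- (w :* e) :- 𝟙 :* (b :- l :* e))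
                 refl (b i) l w (e i) ⟩
          - (w * e i) - 1# * d i       ≈⟨ +-congˡ (-‿cong (*-congʳ -sw≈1)) ⟨
          - (w * e i) - (- s) * w * d i
            ≈⟨ solve 4 (λ s w e d → :- (w :* e) :- (:- s) :* w :* d := w :* (:- e :+ s :* d))
                 refl s w (e i) (d i) ⟩
          w * (- e i + s * d i)        ∎))

    -- If b exceeds every multiple of e then e is negligible against b − t e,
    -- which replaces it.
    extend-unbounded : ∀ b t → t ∈ Below b → (∀ s → s ∉ Above b) →
      ExtensionSpanning K e b
    extend-unbounded b t t∈ above∅ = record
      { pointed = record
        { cone = cone′
        ; e∈K  = ⊆-⊕ cone e t∈
        -- The vector -(b - t e) + s e is (t + s) e - b, so its membership in `K` would put `t + s`
        -- in `Above b`.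
        ; -e∉K = λ (s , Kv) → above∅ (t + s) (cone-resp cone Kv λ i →
            solve 4 (λ t s e b → (t :+ s) :* e :- b := :- (b :- t :* e) :+ s :* e)
              refl t s (e i) (b i))
        }
      -- Now `e` itself is in the lineality space, so anything spanned before is trivial modulo that
      -- space and gets coefficient zero.
      ; spanned   = λ {v} (c , p) → 0# ,
          lin-isSubspace cone′ 1# c (lin-⊆-⊕ cone e p) e∈lin λ i →
            solve 4 (λ v c e e′ → v :- 𝟘 :* e′ := 𝟙 :* (v :- c :* e) :+ c :* e)
              refl (v i) c (e i) (b i - t * e i)
      ; separable = separable-⊕ cone (e , e∈K) e
      } , 1# , lin-scale cone′ t e∈lin λ i →
        solve 3 (λ b t e → b :- 𝟙 :* (b :- t :* e) := t :* e) refl (b i) t (e i)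
      where
      cone′ : IsCone (K ⊕ e)
      cone′ = ⊕-isCone cone e
      e∈lin : e ∈ lin (K ⊕ e)
      e∈lin = direction∈lin cone (e , e∈K) e

    -- Completeness of the reals enters here: every member of `Above b` bounds `Below b` from above,
    -- so the supremum of `Below b` separates the two sets.
    extend-bounded : ∀ b → ∃ (Below b) → ∃ (Above b) → ExtensionSpanning K e b
    extend-bounded b (s , s∈) (t , t∈) = extend-at b (proj₁ l) (proj₁ (proj₂ l)) λ r r∈ →
      proj₂ (proj₂ l) r λ q q∈ → below≤above b q r q∈ r∈
      where
      l : ∃[ l ] UpperBound (Below b) l × (∀ r → UpperBound (Below b) r → l ≤ r)
      l = supremum (Below b) (s , s∈) (t , λ r r∈ → below≤above b r t r∈ t∈)

    extend : ∀ b → ExtensionSpanning K e b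
    extend b with em {P = ∃ (Below b)} | em {P = ∃ (Above b)}
    -- Nothing constrains `l`, so zero serves.
    ... | no ∄below    | no ∄above    = extend-at b 0#
      (λ s s∈ → contradiction (s , s∈) ∄below) (λ t t∈ → contradiction (t , t∈) ∄above)
    ... | yes below    | yes above    = extend-bounded b below above
    ... | yes (t , t∈) | no ∄above    = extend-unbounded b t t∈ λ s s∈ → ∄above (s , s∈)
    -- Negation exchanges the two sets: `t` is in `Above b` exactly when `- t` is in
    -- `Below (neg b)`.
    ... | no ∄below    | yes (t , t∈) = spanning-neg (extend-unbounded (neg b) (- t)
      (cone-resp cone t∈ λ i →
        solve 3 (λ b t e → :- b :- (:- t) :* e := t :* e :- b) refl (b i) t (e i))
      (λ s s∈ → ∄below (- s , cone-resp cone s∈ λ i →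
        solve 3 (λ b s e → b :- (:- s) :* e := s :* e :- (:- b)) refl (b i) s (e i))))

  extend-all : ∀ {m} (b : Fin m → V) {K e} → Pointed K e →
    Σ (Extension K e) λ E → ∀ j → Spanned (Extension.K′ E) (Extension.e′ E) (b j)
  extend-all {0} b P = record { pointed = P ; spanned = id ; separable = id } , λ ()
  extend-all {ℕ.suc m} b {K} {e} P = record
    { pointed   = F.pointed
    ; spanned   = F.spanned ∘ E.spanned
    ; separable = E.separable ∘ F.separable
    } , λ { zero → F.spanned (proj₂ first) ; (suc j) → proj₂ rest j }
    where
    first : ExtensionSpanning K e (b zero)
    first = extend P (b zero)
    module E = Extension (proj₁ first)
    rest : Σ (Extension E.K′ E.e′) λ F →
      ∀ j → Spanned (Extension.K′ F) (Extension.e′ F) (b (suc j))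
    rest = extend-all (b ∘ suc) E.pointed
    module F = Extension (proj₁ rest)

  -- Extending along the standard basis makes every v equal to (φ ∙ v) e′ modulo the lineality
  -- space. A member of the cone with φ ∙ v < 0 would then put a negative multiple of e′ in the
  -- cone.
  separable : ∀ {K e} → Pointed K e → Separable K
  separable {K} {e} P = E.separable (φ , φ≥0 , E.e′ , e∈K , φe>0)
    where
    extension : Σ (Extension K e) λ E →
      ∀ j → Spanned (Extension.K′ E) (Extension.e′ E) (unit j)
    extension = extend-all unit P
    module E = Extension (proj₁ extension)
    open Pointed E.pointed

    φ : V
    φ j = proj₁ (proj₂ extension j)

    coordinates : ∀ v → (λ i → v i - (φ ∙ v) * E.e′ i) ∈ lin E.K′
    coordinates v = lin-scale cone 1#
      (subspace-sum (lin-isSubspace cone) 0∈lin v _ (proj₂ ∘ proj₂ extension)) λ i → begin-equality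
        v i - (φ ∙ v) * E.e′ i
          ≈⟨ solve 3 (λ v x e → v :- x :* e := 𝟙 :* (𝟙 :* v :+ :- e :* x)) refl (v i) (φ ∙ v) (E.e′ i) ⟩
        1# * (1# * v i + - E.e′ i * (φ ∙ v))
          ≈⟨ *-congˡ (+-congʳ (*-congˡ (unit-∙ i v))) ⟨
        1# * (1# * (unit i ∙ v) + - E.e′ i * (φ ∙ v))
          ≈⟨ *-congˡ (sum-comb 1# (- E.e′ i) (λ j → trans
               (*-congˡ (+-congʳ (unit-sym j i)))
               (solve 4 (λ v u p e → v :* (u :- p :* e) := 𝟙 :* (u :* v) :+ :- e :* (p :* v))
                 refl (v j) (unit i j) (φ j) (E.e′ i)))) ⟨
        1# * sum (λ j → v j * (unit j i - φ j * E.e′ i)) ∎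
      where
      0∈lin : ∃ (lin E.K′)
      0∈lin = (λ _ → 0#) ,
        cone-scale cone 0# ≤-refl e∈K (λ i → sym (zeroˡ _)) ,
        cone-scale cone 0# ≤-refl e∈K (λ i →
          solve 1 (λ e → :- 𝟘 := 𝟘 :* e) refl (E.e′ i))

    φ≥0 : ∀ {v} → E.K′ v → 0# ≤ φ ∙ v
    φ≥0 {v} Kv = ≮⇒≥ λ φv<0 → negative∉K (φ ∙ v) φv<0 (λ _ → refl)
      (cone 1# 1# (<⇒≤ 0<1) (<⇒≤ 0<1) Kv (proj₂ (coordinates v)) λ i →
        solve 3 (λ v x e → x :* e := 𝟙 :* v :+ 𝟙 :* :- (v :- x :* e)) refl (v i) (φ ∙ v) (E.e′ i))

    φe>0 : 0# < φ ∙ E.e′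
    φe>0 with compare 0# (φ ∙ E.e′)
    ... | tri< 0<φe _ _ = 0<φe
    -- If `φ` vanished on e′, then `coordinates` would put e′ in the lineality space and -e′ in the
    -- cone.
    ... | tri≈ _ 0≈φe _ = contradiction (cone-resp cone (proj₂ (coordinates E.e′)) λ i →
      begin-equality
        - E.e′ i                          ≈⟨ solve 1 (λ e → :- e := :- (e :- 𝟘 :* e)) refl (E.e′ i) ⟩
        - (E.e′ i - 0# * E.e′ i)          ≈⟨ -‿cong (+-congˡ (-‿cong (*-congʳ 0≈φe))) ⟩
        - (E.e′ i - (φ ∙ E.e′) * E.e′ i)  ∎) -e∉K
    ... | tri> _ _ φe<0 = contradiction (φ≥0 e∈K) (<⇒≱ φe<0)

-- Weights of vectors in the cone of a family, and their linear bounds.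

module Gauge (em : ExcludedMiddle 0ℓ) (ℝ : CompleteOrderedField) {k : ℕ} where
  open OrderedField ℝ
  open Cones em ℝ {k}
  open RingSolver commutativeRing

  module _ {X : Set} (d : X → Fin k → Carrier) where

    -- If nonnegative multiples with total weight T of vectors d x add up to v,
    -- then Reach T v holds; the dual definition avoids handling such combinations.
    Reach : Carrier → Pred (Fin k → Carrier) 0ℓ
    Reach T v = ∀ σ m → 0# ≤ m → (∀ x → 0# ≤ m + σ ∙ d x) → 0# ≤ T * m + σ ∙ v

    Reachable : Pred (Fin k → Carrier) 0ℓ
    Reachable v = ∃[ T ] 0# ≤ T × Reach T v

    -- Weights combine like the vectors, and enlarging a weight is harmless because `m` is
    -- nonnegative.
    reach-comb : ∀ {S T U u v w} a b → 0# ≤ a → 0# ≤ b → a * S + b * T ≤ U →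
      Reach S u → Reach T v → (∀ i → w i ≈ a * u i + b * v i) → Reach U w
    reach-comb {S} {T} {U} {u} {v} {w} a b 0≤a 0≤b ≤U Ru Rv w≈ σ m 0≤m bound =
      ≤-respʳ-≈ (begin-equality
        (U - (a * S + b * T)) * m + (a * (S * m + σ ∙ u) + b * (T * m + σ ∙ v))
          ≈⟨ solve 8 (λ U a S b T m x y →
               (U :- (a :* S :+ b :* T)) :* m :+ (a :* (S :* m :+ x) :+ b :* (T :* m :+ y))
               := U :* m :+ (a :* x :+ b :* y)) refl U a S b T m (σ ∙ u) (σ ∙ v) ⟩
        U * m + (a * (σ ∙ u) + b * (σ ∙ v))
          ≈⟨ +-congˡ (∙-comb {u = u} {v} σ a b w≈) ⟨
        U * m + σ ∙ w ∎)
      (+-nonneg (*-nonneg (x≤y⇒0≤y-x ≤U) 0≤m)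
        (+-nonneg (*-nonneg 0≤a (Ru σ m 0≤m bound)) (*-nonneg 0≤b (Rv σ m 0≤m bound))))

    reachable-isCone : IsCone Reachable
    reachable-isCone a b 0≤a 0≤b (S , 0≤S , Ru) (T , 0≤T , Rv) w≈ =
      a * S + b * T , +-nonneg (*-nonneg 0≤a 0≤S) (*-nonneg 0≤b 0≤T) ,
      reach-comb a b 0≤a 0≤b ≤-refl Ru Rv w≈

    generator-reachable : ∀ x → Reachable (d x)
    generator-reachable x = 1# , <⇒≤ 0<1 , λ σ m _ bound →
      ≤-respʳ-≈ (+-congʳ (sym (*-identityˡ m))) (bound x)

    -- The weight is at most `B` times the maximum norm, so it tends to zero at the origin of `W`.
    UniformlyReachable : Pred (Fin k → Carrier) 0ℓ → Set
    UniformlyReachable W = ∃[ B ] 0# ≤ B ×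
      (∀ v r → 0# ≤ r → W v → (∀ i → Within r (v i)) → Reach (B * r) v)

    zero-uniform : ∀ {W} → (∀ v → W v → ∀ i → v i ≈ 0#) → UniformlyReachable W
    zero-uniform W≈0 = 0# , ≤-refl , λ v r 0≤r Wv _ σ m 0≤m _ →
      ≤-respʳ-≈ (sym (+-congˡ (sum-zero λ i → trans (*-congˡ (W≈0 v Wv i)) (zeroʳ _))))
        (≤-respʳ-≈ (sym (+-identityʳ _))
          (*-nonneg (*-nonneg ≤-refl 0≤r) 0≤m))

    common-bound : ∀ {n} (u : Fin n → Carrier) → ∃[ U ] 0# ≤ U × (∀ i → Within U (u i))
    common-bound {0} u = 0# , ≤-refl , λ ()
    common-bound {ℕ.suc n} u with within-bound (u zero) | common-bound (u ∘ suc)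
    ... | r , 0≤r , p | s , 0≤s , q = r + s , +-nonneg 0≤r 0≤s , λ
      { zero    → within-mono (0≤y-x⇒x≤y (≤-respʳ-≈
          (solve 2 (λ r s → s := r :+ s :- r) refl r s) 0≤s)) p
      ; (suc i) → within-mono (0≤y-x⇒x≤y (≤-respʳ-≈
          (solve 2 (λ r s → r := r :+ s :- s) refl r s) 0≤r)) (q i) }

    -- Restoring a u to v - a u costs |a| S or |a| T according to the sign of `a`; both are at most
    -- (S + T) r.
    reach-shear : ∀ {R S T r u v} a → 0# ≤ S → 0# ≤ T → Within r a →
      Reach R (λ i → v i - a * u i) → Reach S u → Reach T (neg u) →
      Reach (R + (S + T) * r) v
    reach-shear {R} {S} {T} {r} {u} {v} a 0≤S 0≤T (0≤r+a , 0≤r-a) Rv′ Ru R-u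
      with nonneg-or-nonpos a
    ... | inj₁ 0≤a = reach-comb 1# a (<⇒≤ 0<1) 0≤a
      (0≤y-x⇒x≤y (≤-respʳ-≈
        (solve 5 (λ R S T r a → (r :- a) :* S :+ r :* T
          := R :+ (S :+ T) :* r :- (𝟙 :* R :+ a :* S)) refl R S T r a)
        (+-nonneg (*-nonneg 0≤r-a 0≤S) (*-nonneg 0≤r 0≤T))))
      Rv′ Ru
      λ i → solve 3 (λ v a u → v := 𝟙 :* (v :- a :* u) :+ a :* u) refl (v i) a (u i)
      where
      0≤r : 0# ≤ r
      0≤r = ≤-respʳ-≈ (solve 2 (λ r a → (r :- a) :+ a := r) refl r a) (+-nonneg 0≤r-a 0≤a)
    ... | inj₂ 0≤-a = reach-comb 1# (- a) (<⇒≤ 0<1) 0≤-a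
      (0≤y-x⇒x≤y (≤-respʳ-≈
        (solve 5 (λ R S T r a → (r :+ a) :* T :+ r :* S
          := R :+ (S :+ T) :* r :- (𝟙 :* R :+ (:- a) :* T)) refl R S T r a)
        (+-nonneg (*-nonneg 0≤r+a 0≤T) (*-nonneg 0≤r 0≤S))))
      Rv′ R-u
      λ i → solve 3 (λ v a u → v := 𝟙 :* (v :- a :* u) :+ (:- a) :* (:- u)) refl (v i) a (u i)
      where
      0≤r : 0# ≤ r
      0≤r = ≤-respʳ-≈ (solve 2 (λ r a → (r :+ a) :+ (:- a) := r) refl r a)
        (+-nonneg 0≤r+a 0≤-a)

    -- One step of Gaussian elimination: v − v c u lies in the smaller subspace.
    eliminate : ∀ {W} → IsSubspace W → W ⊆ Reachable → ∀ c u → W u → u c ≈ 1# →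
      UniformlyReachable (λ v → W v × v c ≈ 0#) → UniformlyReachable W
    eliminate {W} sub reach c u Wu uc≈1 (B , 0≤B , uniform)
      with reach Wu | reach W-u | common-bound u
      where
      W-u : W (neg u)
      W-u = sub (- 1#) 0# Wu Wu λ i → solve 1 (λ x → :- x := :- 𝟙 :* x :+ 𝟘 :* x) refl (u i)
    ... | S , 0≤S , Ru | T , 0≤T , R-u | U , 0≤U , u≤U =
      -- The coordinates of v - v c u are within r + r U, which costs B (1 + U) r, and restoring v c
      -- u costs at most (S + T) r.
      B * (1# + U) + (S + T) ,
      +-nonneg (*-nonneg 0≤B 0≤1+U) (+-nonneg 0≤S 0≤T) ,
      λ v r 0≤r Wv v≤r σ m 0≤m bound → ≤-respʳ-≈ (+-congʳ (*-congʳ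
          (solve 5 (λ B U S T r → B :* (r :+ r :* U) :+ (S :+ T) :* r
            := (B :* (𝟙 :+ U) :+ (S :+ T)) :* r) refl B U S T r)))
        (reach-shear (v c) 0≤S 0≤T (v≤r c)
          (uniform _ (r + r * U) (+-nonneg 0≤r (*-nonneg 0≤r 0≤U))
            (sub 1# (- v c) Wv Wu (λ i → solve 3 (λ v a u → v :- a :* u := 𝟙 :* v :+ (:- a) :* u)
              refl (v i) (v c) (u i)) ,
             trans (+-congˡ (-‿cong (*-congˡ uc≈1)))
              (solve 1 (λ a → a :- a :* 𝟙 := 𝟘) refl (v c)))
            (λ i → within-- (v≤r i) (within-* (v≤r c) (u≤U i))))
          Ru R-u σ m 0≤m bound)
      where
      0≤1+U : 0# ≤ 1# + U
      0≤1+U = +-nonneg (<⇒≤ 0<1) 0≤U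

    -- Induction on the list `c` of coordinates that determine a vector of `W`. A coordinate
    -- vanishing on all of `W` is dropped; otherwise a vector nonzero there is scaled to a pivot,
    -- and `W` is cut down to the vectors vanishing there.
    uniform : ∀ {m} (c : Fin m → Fin k) {W} → IsSubspace W → W ⊆ Reachable →
      (∀ v → W v → (∀ j → v (c j) ≈ 0#) → ∀ i → v i ≈ 0#) → UniformlyReachable W
    uniform {0} c sub reach W≈0 = zero-uniform λ v Wv → W≈0 v Wv λ ()
    uniform {ℕ.suc m} c {W} sub reach W≈0
      with em {P = ∃[ u ] W u × ¬ (u (c zero) ≈ 0#)}
    ... | no ∄u = uniform (c ∘ suc) sub reach λ v Wv v≈0 → W≈0 v Wv λ
      { zero    → decidable-stable em λ v≉0 → ∄u (v , Wv , v≉0)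
      ; (suc j) → v≈0 j }
    ... | yes (u , Wu , u≉0) = eliminate sub reach (c zero) (λ i → y * u i)
      (sub y 0# Wu Wu λ i → solve 2 (λ y u → y :* u := y :* u :+ 𝟘 :* u) refl y (u i))
      (trans (*-comm y _) (proj₂ (inverse _ u≉0)))
      (uniform (c ∘ suc) sub′ (reach ∘ proj₁) λ v (Wv , vc≈0) v≈0 → W≈0 v Wv λ
        { zero → vc≈0 ; (suc j) → v≈0 j })
      where
      y : Carrier
      y = proj₁ (inverse _ u≉0)
      sub′ : IsSubspace (λ v → W v × v (c zero) ≈ 0#)
      sub′ a b (Wu , u≈0) (Wv , v≈0) w≈ = sub a b Wu Wv w≈ , (begin-equality
        _                  ≈⟨ w≈ (c zero) ⟩
        _                  ≈⟨ +-cong (*-congˡ u≈0) (*-congˡ v≈0) ⟩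
        a * 0# + b * 0#    ≈⟨ solve 2 (λ a b → a :* 𝟘 :+ b :* 𝟘 := 𝟘) refl a b ⟩
        0#                 ∎)

    -- For d x = β − values x this is the strict coherence of β.
    Balanced : Set
    Balanced = ∀ σ → (∃[ x ] σ ∙ d x < 0#) → (∃[ x ] 0# < σ ∙ d x)

    module _ (balanced : Balanced) where

      -- Otherwise some `φ` is nonnegative on the cone and positive at some u in it. The stakes -φ
      -- then gain nowhere, hence by balance lose nowhere, and reachability of u forces -φ ∙ u to be
      -- nonnegative.
      reachable-neg : ∀ {v} → Reachable v → Reachable (neg v)
      reachable-neg {v} Rv@(T , _ , Tv) = decidable-stable em λ ¬R-v →
        not-separable (separable (record
          { cone = reachable-isCone ; e∈K = Rv ; -e∉K = ¬R-v }))
        where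
        not-separable : ¬ Separable Reachable
        not-separable (φ , φ≥0 , u , (S , _ , Su) , 0<φu) =
          <⇒≱ (0<x⇒-x<0 0<φu) (≤-respʳ-≈
            (trans (+-congˡ (∙-negˡ φ u)) (solve 2 (λ s x → s :* 𝟘 :+ x := x) refl S (- (φ ∙ u))))
            -- With m = 0 the weight `S` disappears from the conclusion.
            (Su (neg φ) 0# ≤-refl λ x → ≤-respʳ-≈
              (sym (trans (+-identityˡ _) (∙-negˡ φ (d x))))
              (x≤0⇒0≤-x (≮⇒≥ (φd≯0 x)))))
          where
          φd≯0 : ∀ x → ¬ (0# < φ ∙ d x)
          φd≯0 x 0<φdx = <⇒≱ (0<-x⇒x<0 (<-respʳ-≈ (∙-negˡ φ (d x′)) (proj₂ gain)))
            (φ≥0 (generator-reachable x′))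
            where
            gain : ∃[ x ] 0# < neg φ ∙ d x
            gain = balanced (neg φ) (x , <-respˡ-≈ (sym (∙-negˡ φ (d x))) (0<x⇒-x<0 0<φdx))
            x′ : X
            x′ = proj₁ gain

      reachable-isSubspace : IsSubspace Reachable
      reachable-isSubspace a b Ru Rv w≈ = proj₁
        (lin-isSubspace reachable-isCone a b (Ru , reachable-neg Ru) (Rv , reachable-neg Rv) w≈)

      -- Near the origin the weight T is less than 1, which forbids σ ∙ v to
      -- exceed all the σ ∙ d x.
      uniform⇒near-origin : X → UniformlyReachable Reachable → ∃[ ε ] 0# < ε ×
        (∀ v → Reachable v → (∀ i → Within ε (v i)) → ¬ (∃[ σ ] ∀ x → σ ∙ d x < σ ∙ v))
      uniform⇒near-origin x₀ (B , 0≤B , reach) with pos-inverse (+-pos-nonneg 0<1 0≤B)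
      -- Since ε = 1/(1 + B), the weight B ε is 1 - ε. Reachability tested on -σ with m = σ ∙ v
      -- would make -ε m nonnegative, although m is positive.
      ... | ε , 0<ε , [1+B]ε≈1 = ε , 0<ε , λ v Rv v≤ε (σ , σd<σv) →
        let 0<σv = exceeds-all⇒pos σ v σd<σv
        in <⇒≱ (0<-x⇒x<0 (<-respʳ-≈ (deficit B ε (σ ∙ v) [1+B]ε≈1) (*-pos 0<ε 0<σv)))
             (≤-respʳ-≈ (+-congˡ (∙-negˡ σ v))
               (reach v ε (<⇒≤ 0<ε) Rv v≤ε (neg σ) (σ ∙ v) (<⇒≤ 0<σv) λ x →
                 ≤-respʳ-≈ (+-congˡ (sym (∙-negˡ σ (d x)))) (x≤y⇒0≤y-x (<⇒≤ (σd<σv x)))))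
        where
        deficit : ∀ B ε m → (1# + B) * ε ≈ 1# → ε * m ≈ - (B * ε * m + - m)
        deficit B ε m [1+B]ε≈1 = begin-equality
          ε * m
            ≈⟨ solve 3 (λ B ε m → ε :* m := (𝟙 :+ B) :* ε :* m :- B :* ε :* m) refl B ε m ⟩
          (1# + B) * ε * m - B * ε * m
            ≈⟨ +-congʳ (*-congʳ [1+B]ε≈1) ⟩
          1# * m - B * ε * m
            ≈⟨ solve 2 (λ x m → 𝟙 :* m :- x :* m := :- (x :* m :+ :- m)) refl (B * ε) m ⟩
          - (B * ε * m + - m) ∎

        -- If no σ ∙ d x is positive, then by balance none is negative, and σ ∙ v exceeds the value
        -- 0 at `x₀`.
        exceeds-all⇒pos : ∀ σ v → (∀ x → σ ∙ d x < σ ∙ v) → 0# < σ ∙ v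
        exceeds-all⇒pos σ v σd<σv with em {P = ∃[ x ] 0# < σ ∙ d x}
        ... | yes (x , 0<σdx) = <-trans 0<σdx (σd<σv x)
        ... | no σd≯0 with compare 0# (σ ∙ d x₀)
        ...   | tri< 0<σd _ _ = contradiction (x₀ , 0<σd) σd≯0
        ...   | tri≈ _ 0≈σd _ = <-respˡ-≈ (sym 0≈σd) (σd<σv x₀)
        ...   | tri> _ _ σd<0 = contradiction (balanced σ (x₀ , σd<0)) σd≯0

      near-origin : X → ∃[ ε ] 0# < ε ×
        (∀ v → Reachable v → (∀ i → Within ε (v i)) → ¬ (∃[ σ ] ∀ x → σ ∙ d x < σ ∙ v))
      near-origin x₀ = uniform⇒near-origin x₀
        -- All `k` coordinates are listed, and they determine the vector.
        (uniform id reachable-isSubspace id (λ _ _ v≈0 → v≈0))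

-- Coherent books and the two inclusions.

module Coherence (em : ExcludedMiddle 0ℓ) (ℝ : CompleteOrderedField) {n k : ℕ}
                 (f : Fin k → McNaughton ℝ n) where
  open OrderedField ℝ
  open Cones em ℝ {k} using (IsSubspace; subspace-sum)
  open Gauge em ℝ {k}
  open RingSolver commutativeRing

  private
    V : Set
    V = Fin k → Carrier

  values : Cube ℝ n → V
  values x i = McNaughton.fun (f i) x

  origin : Cube ℝ n
  origin = (λ _ → 0#) , λ _ → ≤-refl , <⇒≤ 0<1

  S⊆affS : ∀ (S : Pred V 0ℓ) → S ⊆ aff ℝ S
  S⊆affS S {x} x∈S = 1 , (λ _ → 1#) , (λ _ → x) , (λ _ → x∈S) , +-identityʳ 1# ,
    λ i → solve 1 (λ x → x := 𝟙 :* x :+ 𝟘) refl (x i)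

  -- A price below 0 loses surely against the stake 1 on that event alone, and a price above 1
  -- against the stake -1.
  coherent⇒book : ∀ β → Coherent ℝ f β → Book ℝ f β
  coherent⇒book β coherent i =
    ≮⇒≥ (λ βi<0 → coherent (unit i , λ x → begin-strict
      unit i ∙ (λ j → β j - values x j)    ≈⟨ unit-∙ i _ ⟩
      β i - values x i                     <⟨ 0<-x⇒x<0 (<-respʳ-≈
        (solve 2 (λ b v → (:- b) :+ v := :- (b :- v)) refl (β i) (values x i))
        (+-pos-nonneg (x<0⇒0<-x βi<0) (proj₁ (McNaughton.inUnit (f i) x)))) ⟩
      0#                                   ∎)) ,
    ≮⇒≥ λ 1<βi → coherent (neg (unit i) , λ x → begin-strict
      neg (unit i) ∙ (λ j → β j - values x j)    ≈⟨ ∙-negˡ (unit i) _ ⟩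
      - (unit i ∙ (λ j → β j - values x j))      ≈⟨ -‿cong (unit-∙ i _) ⟩
      - (β i - values x i)                       <⟨ 0<x⇒-x<0 (<-respʳ-≈
        (solve 2 (λ b v → (b :- 𝟙) :+ (𝟙 :- v) := b :- v) refl (β i) (values x i))
        (+-pos-nonneg (x<y⇒0<y-x 1<βi) (x≤y⇒0≤y-x (proj₂ (McNaughton.inUnit (f i) x))))) ⟩
      0#                                         ∎)

  -- In the valuation `x` itself every balance is zero.
  values-coherent : ∀ x → values x ∈ CoherentBooks ℝ f
  values-coherent x = (λ i → McNaughton.inUnit (f i) x) , λ (σ , loss) →
    irrefl (sum-zero λ i → trans (*-congˡ (-‿inverseʳ _)) (zeroʳ (σ i))) (loss x)

  ball⇒within : ∀ {β y : V} {ε} → 0# < ε → y ∈ Ball ℝ β ε → ∀ i → Within ε (β i - y i)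
  ball⇒within {β} {y} {ε} 0<ε y∈ i = square<⇒within 0<ε (begin-strict
    (β i - y i) * (β i - y i)
      ≈⟨ solve 2 (λ b y → (b :- y) :* (b :- y) := (y :- b) :* (y :- b)) refl (β i) (y i) ⟩
    (y i - β i) * (y i - β i)    ≤⟨ term≤sum (λ j → square-nonneg (y j - β j)) i ⟩
    _                            <⟨ y∈ ⟩
    ε * ε                        ∎)

  module _ {β : V} where

    center∈ball : ∀ {ε} → 0# < ε → β ∈ Ball ℝ β ε
    center∈ball 0<ε = <-respˡ-≈
      (sym (sum-zero λ i → trans (*-congʳ (-‿inverseʳ (β i))) (zeroˡ _))) (*-pos 0<ε 0<ε)

    -- With s = |v|², the factor t = ε / (1 + s) satisfies t² s < ε².
    small-multiple : ∀ (v : V) {ε} → 0# < ε →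
      ∃[ t ] 0# < t × (λ i → β i + t * v i) ∈ Ball ℝ β ε
    small-multiple v {ε} 0<ε with pos-inverse (+-pos-nonneg 0<1 (∙-self-nonneg v))
    ... | w , 0<w , [1+s]w≈1 = ε * w , *-pos 0<ε 0<w , (begin-strict
      _ ≈⟨ sum-comb (ε * w * (ε * w)) 0# (λ i →
             solve 3 (λ b t v → (b :+ t :* v :- b) :* (b :+ t :* v :- b)
               := t :* t :* (v :* v) :+ 𝟘 :* (v :* v)) refl (β i) (ε * w) (v i)) ⟩
      ε * w * (ε * w) * (v ∙ v) + 0# * (v ∙ v)
        <⟨ 0<y-x⇒x<y (<-respʳ-≈ difference (*-pos (*-pos 0<ε 0<ε)
             (+-pos-nonneg (*-pos 0<w 0<w) (*-nonneg (∙-self-nonneg v) (<⇒≤ 0<w))))) ⟩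
      ε * ε ∎)
      where
      difference : ε * ε * (w * w + (v ∙ v) * w)
                   ≈ ε * ε - (ε * w * (ε * w) * (v ∙ v) + 0# * (v ∙ v))
      difference = begin-equality
        -- With s = v ∙ v, using (1 + s) w = 1 twice turns the positive quantity w² + s w into 1 - s
        -- w².
        ε * ε * (w * w + (v ∙ v) * w)
          ≈⟨ solve 3 (λ e w s → e :* e :* (w :* w :+ s :* w)
               := e :* e :* ((𝟙 :+ s) :* w :- w :+ w :* w)) refl ε w (v ∙ v) ⟩
        ε * ε * ((1# + (v ∙ v)) * w - w + w * w)
          ≈⟨ *-congˡ (+-congʳ (+-congʳ [1+s]w≈1)) ⟩
        ε * ε * (1# - w + w * w)
          ≈⟨ solve 2 (λ e w → e :* e :* (𝟙 :- w :+ w :* w)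
               := e :* e :* (𝟙 :- w :* 𝟙 :+ w :* w)) refl ε w ⟩
        ε * ε * (1# - w * 1# + w * w)
          ≈⟨ *-congˡ (+-congʳ (+-congˡ (-‿cong (*-congˡ [1+s]w≈1)))) ⟨
        ε * ε * (1# - w * ((1# + (v ∙ v)) * w) + w * w)
          ≈⟨ solve 3 (λ e w s → e :* e :* (𝟙 :- w :* ((𝟙 :+ s) :* w) :+ w :* w)
               := e :* e :- (e :* w :* (e :* w) :* s :+ 𝟘 :* s)) refl ε w (v ∙ v) ⟩
        ε * ε - (ε * w * (ε * w) * (v ∙ v) + 0# * (v ∙ v)) ∎

    losses : Cube ℝ n → V
    losses x i = β i - values x i

    strictlyCoherent⇒coherent : StrictlyCoherent ℝ f β → Coherent ℝ f β
    strictlyCoherent⇒coherent strict (σ , loss) with strict σ (origin , loss origin)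
    ... | x , gain = asym gain (loss x)

    -- Weight 1 suffices: if m + σ ∙ (β - s) were negative while every m + σ ∙ losses x is
    -- nonnegative, then the stakes -σ would lose surely against `s`.
    coherent-reachable : ∀ s → Coherent ℝ f s → Reachable losses (λ i → β i - s i)
    coherent-reachable s coherent = 1# , <⇒≤ 0<1 , λ σ m _ bound → ≮⇒≥ λ Tm+σv<0 →
      coherent (neg σ , λ x → begin-strict
        neg σ ∙ (λ i → s i - values x i)         ≈⟨ ∙-negˡ σ _ ⟩
        - (σ ∙ (λ i → s i - values x i))
          ≈⟨ -‿cong (∙-comb {u = losses x} {λ i → β i - s i} σ 1# (- 1#) λ i →
               solve 3 (λ b s v → s :- v := 𝟙 :* (b :- v) :+ :- 𝟙 :* (b :- s))
                 refl (β i) (s i) (values x i)) ⟩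
        - (1# * (σ ∙ losses x) + - 1# * (σ ∙ (λ i → β i - s i)))
          <⟨ 0<x⇒-x<0 (<-respʳ-≈
               (solve 3 (λ m p q → :- (𝟙 :* m :+ q) :+ (m :+ p) := 𝟙 :* p :+ :- 𝟙 :* q)
                 refl m (σ ∙ losses x) (σ ∙ (λ i → β i - s i)))
               (+-pos-nonneg (x<0⇒0<-x Tm+σv<0) (bound x))) ⟩
        0# ∎)

    -- As the weights sum to 1, β - y is the same combination of the differences β - s j. Weights
    -- may be negative, so a cone would not be enough.
    aff-reachable : IsSubspace (Reachable losses) → ∀ y →
      y ∈ aff ℝ (CoherentBooks ℝ f) → Reachable losses (λ i → β i - y i)
    aff-reachable sub y (m , w , s , s∈ , Σw≈1 , y≈) =
      sub 1# 0# R R λ i → begin-equality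
        β i - y i                ≈⟨ +-congˡ (-‿cong (y≈ i)) ⟩
        β i - Σws i              ≈⟨ solve 2 (λ b y → b :- y := b :* 𝟙 :+ :- 𝟙 :* y) refl (β i) (Σws i) ⟩
        β i * 1# + - 1# * Σws i  ≈⟨ +-congʳ (*-congˡ Σw≈1) ⟨
        β i * sum w + - 1# * Σws i
          ≈⟨ sum-comb (β i) (- 1#) (λ j →
               solve 3 (λ w b s → w :* (b :- s) := b :* w :+ :- 𝟙 :* (w :* s))
                 refl (w j) (β i) (s j i)) ⟨
        r i                      ≈⟨ solve 1 (λ r → r := 𝟙 :* r :+ 𝟘 :* r) refl (r i) ⟩
        1# * r i + 0# * r i      ∎
      where
      Σws r : V
      Σws i = sum λ j → w j * s j i
      r i = sum λ j → w j * (β i - s j i)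
      R : Reachable losses r
      R = subspace-sum sub (_ , generator-reachable losses origin) w _
        λ j → coherent-reachable (s j) (proj₂ (s∈ j))

    -- A sure loss of σ against `y` says exactly that σ ∙ (β - y) exceeds every σ ∙ losses x.
    near⇒coherent : IsSubspace (Reachable losses) → ∀ {ε} → 0# < ε →
      (∀ v → Reachable losses v → (∀ i → Within ε (v i)) →
        ¬ (∃[ σ ] ∀ x → σ ∙ losses x < σ ∙ v)) →
      ∀ y → y ∈ Ball ℝ β ε → y ∈ aff ℝ (CoherentBooks ℝ f) → Coherent ℝ f y
    near⇒coherent sub 0<ε near y y∈ball y∈aff (σ , loss) =
      near v (aff-reachable sub y y∈aff) (ball⇒within 0<ε y∈ball)
        (σ , λ x → 0<y-x⇒x<y (<-respʳ-≈ (begin-equality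
          - (σ ∙ (λ i → y i - values x i))
            ≈⟨ -‿cong (∙-comb {u = losses x} {v} σ 1# (- 1#) λ i →
                 solve 3 (λ b y v → y :- v := 𝟙 :* (b :- v) :+ :- 𝟙 :* (b :- y))
                   refl (β i) (y i) (values x i)) ⟩
          - (1# * (σ ∙ losses x) + - 1# * (σ ∙ v))
            ≈⟨ solve 2 (λ p q → :- (𝟙 :* p :+ :- 𝟙 :* q) := q :- p)
                 refl (σ ∙ losses x) (σ ∙ v) ⟩
          σ ∙ v - σ ∙ losses x ∎)
          (x<0⇒0<-x (loss x))))
      where
      v : V
      v i = β i - y i

    strictlyCoherent⇒relint : β ∈ StrictlyCoherentBooks ℝ f →
      β ∈ relint ℝ (CoherentBooks ℝ f)
    strictlyCoherent⇒relint (book , strict) =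
      S⊆affS (CoherentBooks ℝ f) (book , strictlyCoherent⇒coherent strict) ,
      let ε , 0<ε , near = near-origin losses strict origin
      in ε , 0<ε , λ y y∈ball y∈aff → let
        coherent : Coherent ℝ f y
        coherent = near⇒coherent (reachable-isSubspace losses strict) 0<ε near y y∈ball y∈aff
        in coherent⇒book y coherent , coherent

    -- The point is (1 + t) β - t values x, beyond β on the line from values x.
    prolongation∈aff : β ∈ CoherentBooks ℝ f → ∀ x t →
      (λ i → β i + t * losses x i) ∈ aff ℝ (CoherentBooks ℝ f)
    prolongation∈aff β∈D x t = 2 , (1# + t) ∷ - t ∷ [] , β ∷ values x ∷ [] ,
      (λ { zero → β∈D ; (suc zero) → values-coherent x }) ,
      solve 1 (λ t → 𝟙 :+ t :+ (:- t :+ 𝟘) := 𝟙) refl t ,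
      λ i → solve 3 (λ b t v → b :+ t :* (b :- v)
        := (𝟙 :+ t) :* b :+ (:- t :* v :+ 𝟘)) refl (β i) t (values x i)

    -- Passing from β to the prolonged book adds the negative constant t (σ ∙ losses x) to every
    -- balance. Were no balance positive at β, the prolonged book would lose surely.
    coherent-prolongation⇒gain : ∀ σ x t → 0# < t → σ ∙ losses x < 0# →
      Coherent ℝ f (λ i → β i + t * losses x i) → ∃[ x′ ] 0# < σ ∙ losses x′
    coherent-prolongation⇒gain σ x t 0<t loss coherent = decidable-stable em λ no-gain →
      coherent (σ , λ x′ → begin-strict
        σ ∙ (λ i → β i + t * losses x i - values x′ i)
          ≈⟨ ∙-comb {u = losses x′} {losses x} σ 1# t (λ i →
               solve 4 (λ b t l v → (b :+ t :* l) :- v := 𝟙 :* (b :- v) :+ t :* l)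
                 refl (β i) t (losses x i) (values x′ i)) ⟩
        1# * (σ ∙ losses x′) + t * (σ ∙ losses x)
          <⟨ 0<-x⇒x<0 (<-respʳ-≈
               (solve 3 (λ p t q → t :* (:- q) :+ :- p := :- (𝟙 :* p :+ t :* q))
                 refl (σ ∙ losses x′) t (σ ∙ losses x))
               (+-pos-nonneg (*-pos 0<t (x<0⇒0<-x loss))
                 (x≤0⇒0≤-x (≮⇒≥ λ gain → no-gain (x′ , gain))))) ⟩
        0# ∎)

    relint⇒strictlyCoherent : β ∈ relint ℝ (CoherentBooks ℝ f) → β ∈ StrictlyCoherentBooks ℝ f
    relint⇒strictlyCoherent (β∈aff , ε , 0<ε , near) = proj₁ β∈D , λ σ (x , loss) →
      let t , 0<t , y∈ball = small-multiple (losses x) 0<ε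
      in coherent-prolongation⇒gain σ x t 0<t loss
           (proj₂ (near _ y∈ball (prolongation∈aff β∈D x t)))
      where
      β∈D : β ∈ CoherentBooks ℝ f
      -- The definition of `relint` puts β only in the affine hull; membership follows because β
      -- lies in its own ball.
      β∈D = near β (center∈ball 0<ε) β∈aff

theorem3p4 : ExcludedMiddle 0ℓ →
    (ℝ : CompleteOrderedField) →
    (n : ℕ) → n ≥ 1 →
    (k : ℕ) (f : Fin k → McNaughton ℝ n) →
    Injective _≡_ (SameFunction ℝ) f →
    StrictlyCoherentBooks ℝ f ≐ relint ℝ (CoherentBooks ℝ f)
theorem3p4 em ℝ n _ k f _ = strictlyCoherent⇒relint , relint⇒strictlyCoherent
  where open Coherence em ℝ f
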